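{- For any positive integers $n, s, t$ such that $n \geq 10$, $s, t \geq 2$ and $n-1 \geq s+t$, there exists a string C-group $(G,\{\rho_0,\rho_1,\rho_2\})$ of rank $3$ with $|G| = 2^n$ and Schläfli type $\{2^s, 2^t\}$.
   Context: A string C-group of rank $3$ is a pair $(G,\{\rho_0,\rho_1,\rho_2\})$ where $G$ is a group generated by the three involutions $\rho_0,\rho_1,\rho_2$ such that $\rho_0\rho_2=\rho_2\rho_0$ (string property) and, writing $G_I=\langle \rho_i : i\in I\rangle$ for $I\subseteq\{0,1,2\}$, one has $G_I\cap G_J=G_{I\cap J}$ for all $I,J\subseteq\{0,1,2\}$ (intersection property). Its order is $|G|$. Its (Schläfli) type is $\{p_1,p_2\}$ where $p_1$ is the order of $\rho_0\rho_1$ and $p_2$ is the order of $\rho_1\rho_2$. -}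

module Defs where

open import Level using (0ℓ)
open import Data.Nat using (ℕ; zero; suc; _<_)
open import Data.Fin using (Fin)
open import Data.Fin.Subset using (Subset; _∈_; _∩_)
open import Data.Product using (Σ; _×_; ∃)
open import Data.Sum using (_⊎_)
open import Relation.Binary.PropositionalEquality using (_≡_)
open import Relation.Nullary using (¬_)
open import Algebra.Core using (Op₁; Op₂)
open import Algebra.Structures using (IsGroup)

data Gen {A : Set} (_∙_ : Op₂ A) (ε : A) (_⁻¹ : Op₁ A) (P : A → Set) : A → Set where
  gen : ∀ {x} → P x → Gen _∙_ ε _⁻¹ P x
  one : Gen _∙_ ε _⁻¹ P ε
  mul : ∀ {x y} → Gen _∙_ ε _⁻¹ P x → Gen _∙_ ε _⁻¹ P y → Gen _∙_ ε _⁻¹ P (x ∙ y)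
  inv : ∀ {x} → Gen _∙_ ε _⁻¹ P x → Gen _∙_ ε _⁻¹ P (x ⁻¹)

pow : {A : Set} → Op₂ A → A → A → ℕ → A
pow _∙_ ε x zero    = ε
pow _∙_ ε x (suc k) = x ∙ pow _∙_ ε x k

HasOrder : {A : Set} → Op₂ A → A → A → ℕ → Set
HasOrder _∙_ ε x k =
  (0 < k) × (pow _∙_ ε x k ≡ ε) × (∀ j → 0 < j → j < k → ¬ (pow _∙_ ε x j ≡ ε))

record StringCGroup3 : Set₁ where
  field
    Carrier : Set
    _∙_     : Op₂ Carrier
    ε       : Carrier
    _⁻¹     : Op₁ Carrier
    isGroup : IsGroup _≡_ _∙_ ε _⁻¹
    ρ       : Fin 3 → Carrier

  G[_] : Subset 3 → Carrier → Set
  G[ I ] = Gen _∙_ ε _⁻¹ (λ y → ∃ λ i → i ∈ I × y ≡ ρ i)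

  field
    involution   : ∀ i → HasOrder _∙_ ε (ρ i) 2
    stringProp   : ρ Fin.zero ∙ ρ (Fin.suc (Fin.suc Fin.zero))
                     ≡ ρ (Fin.suc (Fin.suc Fin.zero)) ∙ ρ Fin.zero
    generates    : ∀ x → Gen _∙_ ε _⁻¹ (λ y → ∃ λ i → y ≡ ρ i) x
    intersection : ∀ I J x → G[ I ] x → G[ J ] x → G[ I ∩ J ] x

{-# OPTIONS --safe #-}
module Submission where

-- Write ρ₀′, ρ₂′ for the conjugates of ρ₀, ρ₂ by ρ₁.  We start from the infinite group U in which
-- the commutators (ρ₀ρ₀′)², (ρ₂ρ₂′)², (ρ₀ρ₂′)², (ρ₀′ρ₂)² generate a normal subgroup ℤ⁴ and the quotient
-- has order 32; it is generated by the triples of generators in the product of two infinite dihedral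
-- groups (with ρ₂ = 1, respectively ρ₀ = 1) and the plane group [4,4].  Here (ρ₀ρ₁)⁴ and (ρ₁ρ₂)⁴ generate the first two copies of ℤ, which
-- are reduced modulo 2^(s−2) and 2^(t−2).  On the other two, which form the square lattice, one divides by
-- an invariant sublattice, of index 2^r with r = n−1−s−t: a multiple of ℤ² if r is even, and of
-- the checkerboard lattice if r is odd (these give the toroidal maps {4,4}_(b,0) and {4,4}_(b,b)).
-- For the intersection property, each G_I is exactly the set of elements for which the coordinates
-- belonging to the missing generators vanish.

open import Defs
open import Algebra.Core using (Op₁; Op₂)
open import Algebra.Definitions using (Associative; LeftIdentity; RightIdentity; LeftInverse; RightInverse)
open import Algebra.Structures using (IsGroup)
open import Data.Bool using (Bool; true; false; _xor_; _∧_)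
open import Data.Bool.Properties using (xor-assoc; xor-same; xor-identityʳ; ∧-comm; _≟_)
open import Data.Fin as Fin using (Fin; toℕ; fromℕ<)
open import Data.Fin.Patterns using (0F; 1F; 2F)
import Data.Fin.Properties as Fin
open import Data.Fin.Subset using (Subset; _∈_; _∉_; _∩_; ⊤)
open import Data.Fin.Subset.Properties using (_∈?_; x∈p∩q⁺; ∈⊤)
open import Data.Integer as ℤ using (ℤ; +_; -[1+_]; -_; _+_; _*_; _-_; 0ℤ; 1ℤ; -1ℤ; ∣_∣; _⊖_)
open import Data.Integer.DivMod using (_%ℕ_; _/ℕ_; n%ℕd<d; a≡a%ℕn+[a/ℕn]*n)
open import Data.Integer.Divisibility.Signed using (_∣_; divides; ∣-trans; ∣m∣n⇒∣m+n; ∣m∣n⇒∣m-n; ∣m⇒∣-m; ∣n⇒∣m*n; ∣⇒∣ᵤ; ∣ᵤ⇒∣)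
import Data.Integer.Properties as ℤ
open import Data.Integer.Tactic.RingSolver using (solve-∀)
open import Data.Nat as ℕ using (ℕ; zero; suc; NonZero; _≤_; _^_; _∸_; s≤s; z<s; ⌊_/2⌋; ⌈_/2⌉)
import Data.Nat.Divisibility as ℕ
import Data.Nat.DivMod as ℕ
import Data.Nat.Properties as ℕ
open import Data.Nat.Tactic.RingSolver using () renaming (solve-∀ to ℕ-solve-∀)
open import Data.Product using (Σ; ∃; _×_; _,_; proj₁; proj₂)
open import Data.Product.Function.NonDependent.Propositional using (_×-↔_)
open import Data.Sum using (_⊎_; inj₁; inj₂)
open import Function.Bundles using (_↔_)
open import Function.Properties.Inverse using (↔-refl; ↔-sym; ↔-trans)
open import Relation.Binary.PropositionalEquality
open import Relation.Nullary using (Dec; yes; no; contradiction)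
open import Relation.Nullary.Decidable using (toWitness; map′; _×-dec_)
open import Relation.Unary using (Decidable)

-- Groups, powers and finite checks.

mkIsGroup : {A : Set} {_∙_ : Op₂ A} {ε : A} {_⁻¹ : Op₁ A} →
  Associative _≡_ _∙_ → LeftIdentity _≡_ ε _∙_ → RightIdentity _≡_ ε _∙_ →
  LeftInverse _≡_ ε _⁻¹ _∙_ → RightInverse _≡_ ε _⁻¹ _∙_ → IsGroup _≡_ _∙_ ε _⁻¹
mkIsGroup {_∙_ = _∙_} {_⁻¹ = _⁻¹} assoc idˡ idʳ invˡ invʳ = record
  { isMonoid = record
    { isSemigroup = record
      { isMagma = record { isEquivalence = isEquivalence ; ∙-cong = cong₂ _∙_ }
      ; assoc = assoc }
    ; identity = idˡ , idʳ }
  ; inverse = invˡ , invʳ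
  ; ⁻¹-cong = cong _⁻¹ }

module _ {A : Set} {_∙_ : Op₂ A} {ε : A} {_⁻¹ : Op₁ A} (isGroup : IsGroup _≡_ _∙_ ε _⁻¹) (x : A) where

  open IsGroup isGroup using (assoc; identityˡ)

  pow-+ : ∀ m n → pow _∙_ ε x (m ℕ.+ n) ≡ pow _∙_ ε x m ∙ pow _∙_ ε x n
  pow-+ zero    n = sym (identityˡ _)
  pow-+ (suc m) n = trans (cong (x ∙_) (pow-+ m n)) (sym (assoc x _ _))

  -- Once the `n`-th power of `x` lies on the one-parameter subgroup `f`, all powers with exponent
  -- divisible by `n` are read off from `f`. It is applied with `n = 4`, where `f` consists of
  -- translations.
  pow-* : (f : ℤ → A) → (∀ k l → f k ∙ f l ≡ f (k + l)) → f 0ℤ ≡ ε →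
    ∀ n → pow _∙_ ε x n ≡ f 1ℤ → ∀ q → pow _∙_ ε x (q ℕ.* n) ≡ f (+ q)
  pow-* f f-hom f-ε n xⁿ zero    = sym f-ε
  pow-* f f-hom f-ε n xⁿ (suc q) =
    trans (pow-+ n (q ℕ.* n)) (trans (cong₂ _∙_ xⁿ (pow-* f f-hom f-ε n xⁿ q)) (f-hom 1ℤ (+ q)))

-- Identities that involve only parities are settled by running this decision over all cases with
-- `toWitness`.
allBool? : {P : Bool → Set} → Decidable P → Dec (∀ b → P b)
allBool? P? = map′ (λ { (f , t) false → f ; (f , t) true → t }) (λ h → h false , h true)
  (P? false ×-dec P? true)

∣∧<⇒≡0 : ∀ {m n} → m ℕ.∣ n → n ℕ.< m → n ≡ 0
∣∧<⇒≡0 {n = zero}  _   _   = refl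
∣∧<⇒≡0 {n = suc n} m∣n n<m = contradiction n<m (ℕ.≤⇒≯ (ℕ.∣⇒≤ m∣n))

-- Congruences of integers

-- A record, so that `a` and `b` can be recovered by unification; a bare divisibility statement
-- about `a - b` would not determine them.
record _≋[_]_ (a : ℤ) (N : ℕ) (b : ℤ) : Set where
  constructor mk≋
  field
    difference : + N ∣ a - b

module _ {N : ℕ} where

  ≋-refl : ∀ a → a ≋[ N ] a
  ≋-refl a = mk≋ (divides 0ℤ (ℤ.+-inverseʳ a))

  ≋-sym : ∀ {a b} → a ≋[ N ] b → b ≋[ N ] a
  ≋-sym {a} {b} (mk≋ h) = mk≋ (subst (+ N ∣_) (lemma a b) (∣m⇒∣-m h))
    where
    lemma : ∀ a b → - (a - b) ≡ b - a
    lemma = solve-∀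

  ≋-trans : ∀ {a b c} → a ≋[ N ] b → b ≋[ N ] c → a ≋[ N ] c
  ≋-trans {a} {b} {c} (mk≋ h) (mk≋ g) = mk≋ (subst (+ N ∣_) (lemma a b c) (∣m∣n⇒∣m+n h g))
    where
    lemma : ∀ a b c → (a - b) + (b - c) ≡ a - c
    lemma = solve-∀

  ≋-+ : ∀ {a b c d} → a ≋[ N ] b → c ≋[ N ] d → (a + c) ≋[ N ] (b + d)
  ≋-+ {a} {b} {c} {d} (mk≋ h) (mk≋ g) = mk≋ (subst (+ N ∣_) (lemma a b c d) (∣m∣n⇒∣m+n h g))
    where
    lemma : ∀ a b c d → (a - b) + (c - d) ≡ (a + c) - (b + d)
    lemma = solve-∀

  ≋-neg : ∀ {a b} → a ≋[ N ] b → (- a) ≋[ N ] (- b)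
  ≋-neg {a} {b} (mk≋ h) = mk≋ (subst (+ N ∣_) (lemma a b) (∣m⇒∣-m h))
    where
    lemma : ∀ a b → - (a - b) ≡ - a - - b
    lemma = solve-∀

  modulus≋0 : (+ N) ≋[ N ] 0ℤ
  modulus≋0 = mk≋ (divides 1ℤ (trans (ℤ.+-identityʳ (+ N)) (sym (ℤ.*-identityˡ (+ N)))))

  ≋0⇒∣ : ∀ {m} → (+ m) ≋[ N ] 0ℤ → N ℕ.∣ m
  ≋0⇒∣ {m} (mk≋ h) = subst (N ℕ.∣_) (cong ∣_∣ (ℤ.+-identityʳ (+ m))) (∣⇒∣ᵤ h)

  module _ .{{_ : NonZero N}} where

    residue : ℤ → Fin N
    residue a = fromℕ< (n%ℕd<d a N)

    repr : Fin N → ℤ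
    repr i = + toℕ i

    -- Two natural numbers below `N` differ by at most their maximum, hence by less than `N`, and
    -- the only multiple of `N` that small is zero.
    ≋⇒≡ : ∀ {m n} → m ℕ.< N → n ℕ.< N → (+ m) ≋[ N ] (+ n) → m ≡ n
    ≋⇒≡ {m} {n} m<N n<N (mk≋ h) = ℤ.+-injective (ℤ.i-j≡0⇒i≡j (+ m) (+ n) (ℤ.∣i∣≡0⇒i≡0
      (∣∧<⇒≡0 (∣⇒∣ᵤ h) (subst (λ z → ∣ z ∣ ℕ.< N) (sym (ℤ.m-n≡m⊖n m n)) bound))))
      where
      bound : ∣ m ⊖ n ∣ ℕ.< N
      bound = ℕ.≤-<-trans (ℤ.∣m⊝n∣≤m⊔n m n) (ℕ.⊔-lub m<N n<N)

    repr-residue : ∀ a → repr (residue a) ≋[ N ] a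
    repr-residue a = ≋-sym (mk≋ (divides (a /ℕ N) (begin
      a - + toℕ (residue a)                    ≡⟨ cong (λ r → a - + r) (Fin.toℕ-fromℕ< _) ⟩
      a - + (a %ℕ N)                           ≡⟨ cong (_- + (a %ℕ N)) (a≡a%ℕn+[a/ℕn]*n a N) ⟩
      + (a %ℕ N) + (a /ℕ N) * + N - + (a %ℕ N) ≡⟨ lemma (+ (a %ℕ N)) _ ⟩
      (a /ℕ N) * + N                           ∎)))
      where
      open ≡-Reasoning
      lemma : ∀ r x → r + x - r ≡ x
      lemma = solve-∀

    residue-cong : ∀ {a b} → a ≋[ N ] b → residue a ≡ residue b
    residue-cong {a} {b} h = Fin.toℕ-injective (≋⇒≡ (Fin.toℕ<n _) (Fin.toℕ<n _)
      (≋-trans (repr-residue a) (≋-trans h (≋-sym (repr-residue b)))))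

    residue-repr : ∀ i → residue (repr i) ≡ i
    residue-repr i = Fin.toℕ-injective (≋⇒≡ (Fin.toℕ<n _) (Fin.toℕ<n i) (repr-residue (repr i)))

    repr-residue-0 : repr (residue 0ℤ) ≡ 0ℤ
    repr-residue-0 = cong +_ (≋⇒≡ (Fin.toℕ<n _) (ℕ.>-nonZero⁻¹ N) (repr-residue 0ℤ))

-- Coordinates on the infinite dihedral group

-- (a , b , k) encodes the isometry x ↦ ±x + (2k + b) of ℤ, where a and b are the parities of the
-- numbers of factors u : x ↦ −x and v : x ↦ 1 − x, so that the sign is − iff a xor b.
-- Below, ⊞ is the k-coordinate of the product of (a , b , k) and (_ , c , l), and kinv and
-- kswap give the k-coordinate of the inverse and of the image under the automorphism u ↔ v.

sgn : Bool → ℤ → ℤ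
sgn false k = k
sgn true  k = - k

bit : Bool → ℤ
bit false = 0ℤ
bit true  = 1ℤ

-- With the sign - when the first argument is `true`, b ± c equals the parity b xor c plus twice
-- this carry. It is what the parity part of the translation 2k + b passes on to k under
-- composition.
carry : Bool → Bool → Bool → ℤ
carry false false c = 0ℤ
carry false true  c = bit c
carry true  false c = - bit c
carry true  true  c = 0ℤ

_⊞⟨_,_,_⟩_ : ℤ → Bool → Bool → Bool → ℤ → ℤ
k ⊞⟨ a , b , c ⟩ l = k + sgn (a xor b) l + carry (a xor b) b c

kinv : Bool → Bool → ℤ → ℤ
kinv a b k = sgn (a xor b) (- (k + carry (a xor b) b b))

kswap : Bool → Bool → ℤ → ℤ
kswap a b k = - k - bit (a ∧ b)

sgn-+ : ∀ d k l → sgn d (k + l) ≡ sgn d k + sgn d l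
sgn-+ false k l = refl
sgn-+ true  k l = ℤ.neg-distrib-+ k l

sgn-neg : ∀ d k → sgn d (- k) ≡ - sgn d k
sgn-neg false k = refl
sgn-neg true  k = refl

sgn-sgn : ∀ d k → sgn d (sgn d k) ≡ k
sgn-sgn false k = refl
sgn-sgn true  k = ℤ.neg-involutive k

sgn-xor : ∀ a b c d k → sgn ((a xor c) xor (b xor d)) k ≡ sgn (a xor b) (sgn (c xor d) k)
sgn-xor a b c d k = trans (cong (λ e → sgn e k) (bits a b c d)) (hom (a xor b) (c xor d) k)
  where
  bits : ∀ a b c d → (a xor c) xor (b xor d) ≡ (a xor b) xor (c xor d)
  bits = toWitness {a? = allBool? λ a → allBool? λ b → allBool? λ c → allBool? λ d → _ ≟ _} _
  hom : ∀ d e k → sgn (d xor e) k ≡ sgn d (sgn e k)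
  hom false e     k = refl
  hom true  false k = refl
  hom true  true  k = sym (ℤ.neg-involutive k)

-- The 2-cocycle condition: associativity in the dihedral group for elements whose k-coordinates are
-- zero.
carry-cocycle : ∀ a b c d e →
  carry (a xor b) b d + carry ((a xor c) xor (b xor d)) (b xor d) e
    ≡ sgn (a xor b) (carry (c xor d) d e) + carry (a xor b) b (d xor e)
carry-cocycle = toWitness
  {a? = allBool? λ a → allBool? λ b → allBool? λ c → allBool? λ d → allBool? λ e → _ ℤ.≟ _} _

-- Signs multiply, so the terms in `k`, `l` and `m` agree on both sides; the rest depends on
-- parities alone and is `carry-cocycle`.
⊞-assoc : ∀ a b c d e k l m →
  (k ⊞⟨ a , b , d ⟩ l) ⊞⟨ a xor c , b xor d , e ⟩ m ≡ k ⊞⟨ a , b , d xor e ⟩ (l ⊞⟨ c , d , e ⟩ m)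
⊞-assoc a b c d e k l m = begin
  k + x + f₁ + sgn ((a xor c) xor (b xor d)) m + f₂ ≡⟨ cong (λ z → k + x + f₁ + z + f₂) (sgn-xor a b c d m) ⟩
  k + x + f₁ + y + f₂                               ≡⟨ shuffle k x y f₁ f₂ ⟩
  k + x + y + (f₁ + f₂)                             ≡⟨ cong (λ z → k + x + y + z) (carry-cocycle a b c d e) ⟩
  k + x + y + (sgn (a xor b) g₁ + g₂)               ≡⟨ regroup k x y (sgn (a xor b) g₁) g₂ ⟩
  k + (x + y + sgn (a xor b) g₁) + g₂               ≡⟨ cong (λ z → k + z + g₂) distrib ⟨
  k + sgn (a xor b) (l + sgn (c xor d) m + g₁) + g₂ ∎
  where
  open ≡-Reasoning
  x = sgn (a xor b) l
  y = sgn (a xor b) (sgn (c xor d) m)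
  f₁ = carry (a xor b) b d
  f₂ = carry ((a xor c) xor (b xor d)) (b xor d) e
  g₁ = carry (c xor d) d e
  g₂ = carry (a xor b) b (d xor e)
  shuffle : ∀ k x y f g → k + x + f + y + g ≡ k + x + y + (f + g)
  shuffle = solve-∀
  regroup : ∀ k x y f g → k + x + y + (f + g) ≡ k + (x + y + f) + g
  regroup = solve-∀
  distrib : sgn (a xor b) (l + sgn (c xor d) m + g₁) ≡ x + y + sgn (a xor b) g₁
  distrib = trans (sgn-+ (a xor b) _ g₁) (cong (_+ sgn (a xor b) g₁) (sgn-+ (a xor b) l _))

⊞-identityˡ : ∀ b k → 0ℤ ⊞⟨ false , false , b ⟩ k ≡ k
⊞-identityˡ b k = trans (ℤ.+-identityʳ _) (ℤ.+-identityˡ k)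

⊞-identityʳ : ∀ a b k → k ⊞⟨ a , b , false ⟩ 0ℤ ≡ k
⊞-identityʳ false false k = trans (ℤ.+-identityʳ _) (ℤ.+-identityʳ k)
⊞-identityʳ false true  k = trans (ℤ.+-identityʳ _) (ℤ.+-identityʳ k)
⊞-identityʳ true  false k = trans (ℤ.+-identityʳ _) (ℤ.+-identityʳ k)
⊞-identityʳ true  true  k = trans (ℤ.+-identityʳ _) (ℤ.+-identityʳ k)

⊞-inverseˡ : ∀ a b k → kinv a b k ⊞⟨ a , b , b ⟩ k ≡ 0ℤ
⊞-inverseˡ a b k = begin
  sgn (a xor b) (- (k + f)) + sgn (a xor b) k + f ≡⟨ cong (_+ f) (sgn-+ (a xor b) (- (k + f)) k) ⟨
  sgn (a xor b) (- (k + f) + k) + f               ≡⟨ cong (λ z → sgn (a xor b) z + f) (lemma k f) ⟩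
  sgn (a xor b) (- f) + f                         ≡⟨ cancel a b ⟩
  0ℤ                                              ∎
  where
  open ≡-Reasoning
  f = carry (a xor b) b b
  lemma : ∀ k f → - (k + f) + k ≡ - f
  lemma = solve-∀
  cancel : ∀ a b → sgn (a xor b) (- carry (a xor b) b b) + carry (a xor b) b b ≡ 0ℤ
  cancel = toWitness {a? = allBool? λ a → allBool? λ b → _ ℤ.≟ _} _

⊞-inverseʳ : ∀ a b k → k ⊞⟨ a , b , b ⟩ kinv a b k ≡ 0ℤ
⊞-inverseʳ a b k = begin
  k + sgn (a xor b) (kinv a b k) + f ≡⟨ cong (λ z → k + z + f) (sgn-sgn (a xor b) _) ⟩
  k + - (k + f) + f                  ≡⟨ lemma k f ⟩
  0ℤ                                 ∎
  where
  open ≡-Reasoning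
  f = carry (a xor b) b b
  lemma : ∀ k f → k + - (k + f) + f ≡ 0ℤ
  lemma = solve-∀

kswap-involutive : ∀ a b k → kswap b a (kswap a b k) ≡ k
kswap-involutive a b k rewrite ∧-comm b a = lemma k (bit (a ∧ b))
  where
  lemma : ∀ k g → - (- k - g) - g ≡ k
  lemma = solve-∀

carry-swap : ∀ a b c d →
  carry (a xor b) b d + bit ((a xor c) ∧ (b xor d))
    ≡ bit (a ∧ b) + sgn (a xor b) (bit (c ∧ d)) - carry (b xor a) a c
carry-swap = toWitness {a? = allBool? λ a → allBool? λ b → allBool? λ c → allBool? λ d → _ ℤ.≟ _} _

-- Exchanging u and v is conjugation by x ↦ 1/2 - x, which interchanges their fixed points 0 and
-- 1/2. In coordinates the terms in `k` and `l` match, and `carry-swap` accounts for the parities.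
kswap-hom : ∀ a b c d k l →
  kswap (a xor c) (b xor d) (k ⊞⟨ a , b , d ⟩ l) ≡ kswap a b k ⊞⟨ b , a , c ⟩ kswap c d l
kswap-hom a b c d k l = begin
  - (k + x + f) - g                     ≡⟨ shuffle k x f g ⟩
  - k - x - (f + g)                     ≡⟨ cong (λ z → - k - x - z) (carry-swap a b c d) ⟩
  - k - x - (h + i - j)                 ≡⟨ regroup k x h i j ⟩
  (- k - h) + (- x - i) + j             ≡⟨ cong (λ z → (- k - h) + z + j) distrib ⟨
  (- k - h) + sgn (b xor a) (- l - bit (c ∧ d)) + j ∎
  where
  open ≡-Reasoning
  x = sgn (a xor b) l
  f = carry (a xor b) b d
  g = bit ((a xor c) ∧ (b xor d))
  h = bit (a ∧ b)
  i = sgn (a xor b) (bit (c ∧ d))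
  j = carry (b xor a) a c
  shuffle : ∀ k x f g → - (k + x + f) - g ≡ - k - x - (f + g)
  shuffle = solve-∀
  regroup : ∀ k x h i j → - k - x - (h + i - j) ≡ (- k - h) + (- x - i) + j
  regroup = solve-∀
  comm : ∀ a b → b xor a ≡ a xor b
  comm = toWitness {a? = allBool? λ a → allBool? λ b → _ ≟ _} _
  distrib : sgn (b xor a) (- l - bit (c ∧ d)) ≡ - x - i
  distrib rewrite comm a b =
    trans (sgn-+ (a xor b) (- l) _) (cong₂ _+_ (sgn-neg (a xor b) l) (sgn-neg (a xor b) _))

module _ {N : ℕ} where

  ≋-sgn : ∀ d {k k'} → k ≋[ N ] k' → sgn d k ≋[ N ] sgn d k'
  ≋-sgn false h = h
  ≋-sgn true  h = ≋-neg h

  ≋-⊞ : ∀ a b c {k l k' l'} → k ≋[ N ] k' → l ≋[ N ] l' → (k ⊞⟨ a , b , c ⟩ l) ≋[ N ] (k' ⊞⟨ a , b , c ⟩ l')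
  ≋-⊞ a b c h g = ≋-+ (≋-+ h (≋-sgn (a xor b) g)) (≋-refl _)

  ≋-kinv : ∀ a b {k k'} → k ≋[ N ] k' → kinv a b k ≋[ N ] kinv a b k'
  ≋-kinv a b h = ≋-sgn (a xor b) (≋-neg (≋-+ h (≋-refl _)))

  ≋-kswap : ∀ a b {k k'} → k ≋[ N ] k' → kswap a b k ≋[ N ] kswap a b k'
  ≋-kswap a b h = ≋-+ (≋-neg h) (≋-refl _)

-- Semidirect products with a group of order 2, and quotients.

module SemidirectC₂ {H : Set} {_∙_ : Op₂ H} {e : H} {_⁻¹ : Op₁ H} (isGroup : IsGroup _≡_ _∙_ e _⁻¹)
  (τ : H → H) (τ-hom : ∀ x y → τ (x ∙ y) ≡ τ x ∙ τ y) (τ-ε : τ e ≡ e) (τ-involutive : ∀ x → τ (τ x) ≡ x) where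

  open IsGroup isGroup using (assoc; identityˡ; identityʳ; inverseˡ; inverseʳ)

  τ^ : Bool → H → H
  τ^ false x = x
  τ^ true  x = τ x

  infixl 7 _⋊_
  _⋊_ : Op₂ (H × Bool)
  (x , s) ⋊ (y , t) = x ∙ τ^ s y , s xor t

  ⋊-ε : H × Bool
  ⋊-ε = e , false

  ⋊-inv : Op₁ (H × Bool)
  ⋊-inv (x , s) = τ^ s (x ⁻¹) , s

  private
    τ^-hom : ∀ s x y → τ^ s (x ∙ y) ≡ τ^ s x ∙ τ^ s y
    τ^-hom false x y = refl
    τ^-hom true  x y = τ-hom x y

    τ^-ε : ∀ s → τ^ s e ≡ e
    τ^-ε false = refl
    τ^-ε true  = τ-ε

    τ^-xor : ∀ s t x → τ^ (s xor t) x ≡ τ^ s (τ^ t x)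
    τ^-xor false t     x = refl
    τ^-xor true  false x = refl
    τ^-xor true  true  x = sym (τ-involutive x)

    τ^-involutive : ∀ s x → τ^ s (τ^ s x) ≡ x
    τ^-involutive false x = refl
    τ^-involutive true  x = τ-involutive x

  ⋊-isGroup : IsGroup _≡_ _⋊_ ⋊-ε ⋊-inv
  ⋊-isGroup = mkIsGroup
    (λ { (x , s) (y , t) (z , u) → cong₂ _,_
      (trans (assoc x (τ^ s y) (τ^ (s xor t) z))
        (cong (x ∙_) (trans (cong (τ^ s y ∙_) (τ^-xor s t z)) (sym (τ^-hom s y (τ^ t z))))))
      (xor-assoc s t u) })
    (λ { (x , s) → cong (_, s) (identityˡ x) })
    (λ { (x , s) → cong₂ _,_ (trans (cong (x ∙_) (τ^-ε s)) (identityʳ x)) (xor-identityʳ s) })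
    (λ { (x , s) → cong₂ _,_ (trans (sym (τ^-hom s (x ⁻¹) x)) (trans (cong (τ^ s) (inverseˡ x)) (τ^-ε s))) (xor-same s) })
    (λ { (x , s) → cong₂ _,_ (trans (cong (x ∙_) (τ^-involutive s (x ⁻¹))) (inverseʳ x)) (xor-same s) })

-- The group laws are wanted up to `_≡_`, so the quotient lives on a set `C` of normal forms: the
-- kernel relation of `π` is a congruence, and `sect` picks the representatives that are multiplied.
module Quotient {U C : Set} {_·_ : Op₂ U} {e : U} {_⁻ : Op₁ U} (isGroup : IsGroup _≡_ _·_ e _⁻)
  (π : U → C) (sect : C → U) (π-sect : ∀ c → π (sect c) ≡ c)
  (·-resp : ∀ {u u' v v'} → π u ≡ π u' → π v ≡ π v' → π (u · v) ≡ π (u' · v'))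
  (⁻-resp : ∀ {u u'} → π u ≡ π u' → π (u ⁻) ≡ π (u' ⁻)) where

  open IsGroup isGroup using (assoc; identityˡ; identityʳ; inverseˡ; inverseʳ)

  infixl 7 _∙_
  _∙_ : Op₂ C
  x ∙ y = π (sect x · sect y)

  ε : C
  ε = π e

  _⁻¹ : Op₁ C
  x ⁻¹ = π (sect x ⁻)

  π-∙ : ∀ u v → π (u · v) ≡ π u ∙ π v
  π-∙ u v = ·-resp (sym (π-sect (π u))) (sym (π-sect (π v)))

  π-⁻¹ : ∀ u → π (u ⁻) ≡ π u ⁻¹
  π-⁻¹ u = ⁻-resp (sym (π-sect (π u)))

  quotient-isGroup : IsGroup _≡_ _∙_ ε _⁻¹
  quotient-isGroup = mkIsGroup
    (λ x y z → trans (·-resp (π-sect _) refl)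
      (trans (cong π (assoc (sect x) (sect y) (sect z))) (·-resp refl (sym (π-sect _)))))
    (λ x → trans (·-resp (π-sect ε) refl) (trans (cong π (identityˡ (sect x))) (π-sect x)))
    (λ x → trans (·-resp refl (π-sect ε)) (trans (cong π (identityʳ (sect x))) (π-sect x)))
    (λ x → trans (·-resp (π-sect _) refl) (cong π (inverseˡ (sect x))))
    (λ x → trans (·-resp refl (π-sect _)) (cong π (inverseʳ (sect x))))

  π-pow : ∀ u n → π (pow _·_ e u n) ≡ pow _∙_ ε (π u) n
  π-pow u zero    = refl
  π-pow u (suc n) = trans (π-∙ u _) (cong (π u ∙_) (π-pow u n))

  π-Gen : ∀ {P : U → Set} {Q : C → Set} → (∀ {u} → P u → Q (π u)) →
    ∀ {u} → Gen _·_ e _⁻ P u → Gen _∙_ ε _⁻¹ Q (π u)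
  π-Gen h (gen p)           = gen (h p)
  π-Gen h one               = one
  π-Gen h (mul {x} {y} g g') = subst (Gen _∙_ ε _⁻¹ _) (sym (π-∙ x y)) (mul (π-Gen h g) (π-Gen h g'))
  π-Gen h (inv {x} g)       = subst (Gen _∙_ ε _⁻¹ _) (sym (π-⁻¹ x)) (inv (π-Gen h g))

-- The infinite group U = N ⋊ ⟨ρ₁⟩

-- p, p', q, q' are the parities of ρ₀, ρ₀′, ρ₂, ρ₂′.  The kᵢ are dihedral coordinates for the pairs
-- (u , v) = (ρ₀ , ρ₀′), (ρ₂ , ρ₂′), (ρ₀ , ρ₂′), (ρ₀′ , ρ₂); the two remaining pairs commute.
record N : Set where
  constructor mkN
  field
    p p' q q'   : Bool
    k₁ k₂ k₃ k₄ : ℤ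

mkN-cong : ∀ {p p' q q' r r' s s' k₁ k₂ k₃ k₄ l₁ l₂ l₃ l₄} →
  p ≡ r → p' ≡ r' → q ≡ s → q' ≡ s' → k₁ ≡ l₁ → k₂ ≡ l₂ → k₃ ≡ l₃ → k₄ ≡ l₄ →
  mkN p p' q q' k₁ k₂ k₃ k₄ ≡ mkN r r' s s' l₁ l₂ l₃ l₄
mkN-cong refl refl refl refl refl refl refl refl = refl

-- A fibre product of four infinite dihedral groups that share their parities, so every group law
-- can be checked in each of them separately.
_·ᴺ_ : Op₂ N
mkN p p' q q' k₁ k₂ k₃ k₄ ·ᴺ mkN r r' s s' l₁ l₂ l₃ l₄ =
  mkN (p xor r) (p' xor r') (q xor s) (q' xor s')
    (k₁ ⊞⟨ p , p' , r' ⟩ l₁) (k₂ ⊞⟨ q , q' , s' ⟩ l₂) (k₃ ⊞⟨ p , q' , s' ⟩ l₃) (k₄ ⊞⟨ p' , q , s ⟩ l₄)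

εᴺ : N
εᴺ = mkN false false false false 0ℤ 0ℤ 0ℤ 0ℤ

invᴺ : Op₁ N
invᴺ (mkN p p' q q' k₁ k₂ k₃ k₄) =
  mkN p p' q q' (kinv p p' k₁) (kinv q q' k₂) (kinv p q' k₃) (kinv p' q k₄)

-- Conjugation by ρ₁. It reverses the pairs (ρ₀ , ρ₀′) and (ρ₂ , ρ₂′), hence `kswap`, but carries
-- (ρ₀ , ρ₂′) to (ρ₀′ , ρ₂) in the same order, so `k₃` and `k₄` are merely exchanged.
swap : N → N
swap (mkN p p' q q' k₁ k₂ k₃ k₄) = mkN p' p q' q (kswap p p' k₁) (kswap q q' k₂) k₄ k₃

N-isGroup : IsGroup _≡_ _·ᴺ_ εᴺ invᴺ
N-isGroup = mkIsGroup
  (λ { (mkN p p' q q' k₁ k₂ k₃ k₄) (mkN r r' s s' l₁ l₂ l₃ l₄) (mkN u u' v v' m₁ m₂ m₃ m₄) →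
    mkN-cong (xor-assoc p r u) (xor-assoc p' r' u') (xor-assoc q s v) (xor-assoc q' s' v')
      (⊞-assoc p p' r r' u' k₁ l₁ m₁) (⊞-assoc q q' s s' v' k₂ l₂ m₂)
      (⊞-assoc p q' r s' v' k₃ l₃ m₃) (⊞-assoc p' q r' s v k₄ l₄ m₄) })
  (λ { (mkN p p' q q' k₁ k₂ k₃ k₄) → mkN-cong refl refl refl refl
      (⊞-identityˡ p' k₁) (⊞-identityˡ q' k₂) (⊞-identityˡ q' k₃) (⊞-identityˡ q k₄) })
  (λ { (mkN p p' q q' k₁ k₂ k₃ k₄) →
    mkN-cong (xor-identityʳ p) (xor-identityʳ p') (xor-identityʳ q) (xor-identityʳ q')
      (⊞-identityʳ p p' k₁) (⊞-identityʳ q q' k₂) (⊞-identityʳ p q' k₃) (⊞-identityʳ p' q k₄) })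
  (λ { (mkN p p' q q' k₁ k₂ k₃ k₄) →
    mkN-cong (xor-same p) (xor-same p') (xor-same q) (xor-same q')
      (⊞-inverseˡ p p' k₁) (⊞-inverseˡ q q' k₂) (⊞-inverseˡ p q' k₃) (⊞-inverseˡ p' q k₄) })
  (λ { (mkN p p' q q' k₁ k₂ k₃ k₄) →
    mkN-cong (xor-same p) (xor-same p') (xor-same q) (xor-same q')
      (⊞-inverseʳ p p' k₁) (⊞-inverseʳ q q' k₂) (⊞-inverseʳ p q' k₃) (⊞-inverseʳ p' q k₄) })

swap-hom : ∀ x y → swap (x ·ᴺ y) ≡ swap x ·ᴺ swap y
swap-hom (mkN p p' q q' k₁ k₂ k₃ k₄) (mkN r r' s s' l₁ l₂ l₃ l₄) = mkN-cong refl refl refl refl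
  (kswap-hom p p' r r' k₁ l₁) (kswap-hom q q' s s' k₂ l₂) refl refl

swap-involutive : ∀ x → swap (swap x) ≡ x
swap-involutive (mkN p p' q q' k₁ k₂ k₃ k₄) = mkN-cong refl refl refl refl
  (kswap-involutive p p' k₁) (kswap-involutive q q' k₂) refl refl

open SemidirectC₂ N-isGroup swap swap-hom refl swap-involutive
  renaming (_⋊_ to _·_; ⋊-ε to εᵁ; ⋊-inv to invᵁ; ⋊-isGroup to U-isGroup)

U : Set
U = N × Bool

ρᵁ : Fin 3 → U
ρᵁ 0F = mkN true false false false 0ℤ 0ℤ 0ℤ 0ℤ , false
ρᵁ 1F = εᴺ , true
ρᵁ 2F = mkN false false true false 0ℤ 0ℤ 0ℤ 0ℤ , false

-- Vanish i is the subgroup generated by the ρⱼ with j ≠ i.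
data Vanish : Fin 3 → U → Set where
  vanish₀ : ∀ {q q' k₂ σ} → Vanish 0F (mkN false false q q' 0ℤ k₂ 0ℤ 0ℤ , σ)
  vanish₁ : ∀ {p q} → Vanish 1F (mkN p false q false 0ℤ 0ℤ 0ℤ 0ℤ , false)
  vanish₂ : ∀ {p p' k₁ σ} → Vanish 2F (mkN p p' false false k₁ 0ℤ 0ℤ 0ℤ , σ)

Vanish-ρ : ∀ i j → i ≢ j → Vanish i (ρᵁ j)
Vanish-ρ 0F 0F i≢j = contradiction refl i≢j
Vanish-ρ 0F 1F _   = vanish₀
Vanish-ρ 0F 2F _   = vanish₀
Vanish-ρ 1F 0F _   = vanish₁
Vanish-ρ 1F 1F i≢j = contradiction refl i≢j
Vanish-ρ 1F 2F _   = vanish₁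
Vanish-ρ 2F 0F _   = vanish₂
Vanish-ρ 2F 1F _   = vanish₂
Vanish-ρ 2F 2F i≢j = contradiction refl i≢j

Vanish-ε : ∀ i → Vanish i εᵁ
Vanish-ε 0F = vanish₀
Vanish-ε 1F = vanish₁
Vanish-ε 2F = vanish₂

-- Each coordinate required to be zero belongs to a pair with at least one member absent, and a
-- single reflection produces no carry. Splitting on the parities and `σ` of the left factor lets
-- this compute.
Vanish-· : ∀ {i u v} → Vanish i u → Vanish i v → Vanish i (u · v)
Vanish-· (vanish₀ {false} {false} {σ = false}) vanish₀ = vanish₀
Vanish-· (vanish₀ {false} {false} {σ = true})  vanish₀ = vanish₀
Vanish-· (vanish₀ {false} {true}  {σ = false}) vanish₀ = vanish₀
Vanish-· (vanish₀ {false} {true}  {σ = true})  vanish₀ = vanish₀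
Vanish-· (vanish₀ {true}  {false} {σ = false}) vanish₀ = vanish₀
Vanish-· (vanish₀ {true}  {false} {σ = true})  vanish₀ = vanish₀
Vanish-· (vanish₀ {true}  {true}  {σ = false}) vanish₀ = vanish₀
Vanish-· (vanish₀ {true}  {true}  {σ = true})  vanish₀ = vanish₀
Vanish-· (vanish₁ {false} {false}) vanish₁ = vanish₁
Vanish-· (vanish₁ {false} {true})  vanish₁ = vanish₁
Vanish-· (vanish₁ {true}  {false}) vanish₁ = vanish₁
Vanish-· (vanish₁ {true}  {true})  vanish₁ = vanish₁
Vanish-· (vanish₂ {false} {false} {σ = false}) vanish₂ = vanish₂
Vanish-· (vanish₂ {false} {false} {σ = true})  vanish₂ = vanish₂
Vanish-· (vanish₂ {false} {true}  {σ = false}) vanish₂ = vanish₂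
Vanish-· (vanish₂ {false} {true}  {σ = true})  vanish₂ = vanish₂
Vanish-· (vanish₂ {true}  {false} {σ = false}) vanish₂ = vanish₂
Vanish-· (vanish₂ {true}  {false} {σ = true})  vanish₂ = vanish₂
Vanish-· (vanish₂ {true}  {true}  {σ = false}) vanish₂ = vanish₂
Vanish-· (vanish₂ {true}  {true}  {σ = true})  vanish₂ = vanish₂

Vanish-inv : ∀ {i u} → Vanish i u → Vanish i (invᵁ u)
Vanish-inv (vanish₀ {false} {false} {σ = false}) = vanish₀
Vanish-inv (vanish₀ {false} {false} {σ = true})  = vanish₀
Vanish-inv (vanish₀ {false} {true}  {σ = false}) = vanish₀
Vanish-inv (vanish₀ {false} {true}  {σ = true})  = vanish₀
Vanish-inv (vanish₀ {true}  {false} {σ = false}) = vanish₀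
Vanish-inv (vanish₀ {true}  {false} {σ = true})  = vanish₀
Vanish-inv (vanish₀ {true}  {true}  {σ = false}) = vanish₀
Vanish-inv (vanish₀ {true}  {true}  {σ = true})  = vanish₀
Vanish-inv (vanish₁ {false} {false}) = vanish₁
Vanish-inv (vanish₁ {false} {true})  = vanish₁
Vanish-inv (vanish₁ {true}  {false}) = vanish₁
Vanish-inv (vanish₁ {true}  {true})  = vanish₁
Vanish-inv (vanish₂ {false} {false} {σ = false}) = vanish₂
Vanish-inv (vanish₂ {false} {false} {σ = true})  = vanish₂
Vanish-inv (vanish₂ {false} {true}  {σ = false}) = vanish₂
Vanish-inv (vanish₂ {false} {true}  {σ = true})  = vanish₂
Vanish-inv (vanish₂ {true}  {false} {σ = false}) = vanish₂
Vanish-inv (vanish₂ {true}  {false} {σ = true})  = vanish₂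
Vanish-inv (vanish₂ {true}  {true}  {σ = false}) = vanish₂
Vanish-inv (vanish₂ {true}  {true}  {σ = true})  = vanish₂

-- Translations, and the subgroups of `U` generated by sets of generators.

T : ℤ → ℤ → ℤ → ℤ → U
T k₁ k₂ k₃ k₄ = mkN false false false false k₁ k₂ k₃ k₄ , false

-- A translation on the left has trivial parities, so it causes neither signs nor carries.
T-· : ∀ k₁ k₂ k₃ k₄ p p' q q' l₁ l₂ l₃ l₄ σ →
  T k₁ k₂ k₃ k₄ · (mkN p p' q q' l₁ l₂ l₃ l₄ , σ) ≡ (mkN p p' q q' (k₁ + l₁) (k₂ + l₂) (k₃ + l₃) (k₄ + l₄) , σ)
T-· k₁ k₂ k₃ k₄ p p' q q' l₁ l₂ l₃ l₄ σ = cong (_, σ) (mkN-cong refl refl refl refl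
  (ℤ.+-identityʳ _) (ℤ.+-identityʳ _) (ℤ.+-identityʳ _) (ℤ.+-identityʳ _))

module _ (K : Subset 3) where

  ⟨ρ⟩ : U → Set
  ⟨ρ⟩ = Gen _·_ εᵁ invᵁ (λ u → ∃ λ i → i ∈ K × u ≡ ρᵁ i)

  private
    generator : ∀ {i} → i ∈ K → ⟨ρ⟩ (ρᵁ i)
    generator i∈K = gen (_ , i∈K , refl)

    conjugate : ∀ {u v} → ⟨ρ⟩ u → ⟨ρ⟩ v → ⟨ρ⟩ ((u · v) · u)
    conjugate g h = mul (mul g h) g

    square : ∀ {u v} → ⟨ρ⟩ u → ⟨ρ⟩ v → ⟨ρ⟩ ((u · v) · (u · v))
    square g h = mul (mul g h) (mul g h)

    multiples : (f : ℤ → U) → (∀ k l → f k · f l ≡ f (k + l)) → f 0ℤ ≡ εᵁ →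
      ⟨ρ⟩ (f 1ℤ) → ⟨ρ⟩ (f -1ℤ) → ∀ z → ⟨ρ⟩ (f z)
    multiples f f-hom f-ε g h (+ zero)        = subst ⟨ρ⟩ (sym f-ε) one
    multiples f f-hom f-ε g h (+ suc n)       =
      subst ⟨ρ⟩ (f-hom 1ℤ (+ n)) (mul g (multiples f f-hom f-ε g h (+ n)))
    multiples f f-hom f-ε g h -[1+ zero ]     = h
    multiples f f-hom f-ε g h -[1+ suc n ]    =
      subst ⟨ρ⟩ (f-hom -1ℤ -[1+ n ]) (mul h (multiples f f-hom f-ε g h -[1+ n ]))

    -- The word is formed in the order ρ₂′, ρ₂, ρ₀′, ρ₀, ρ₁. In each of the four dihedral pairs v
    -- then stands to the left of u, so no carry arises and all translation coordinates stay zero.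
    bits : ∀ {p p' q q' σ k₁ k₂ k₃ k₄} → (∀ i → i ∈ K ⊎ Vanish i (mkN p p' q q' k₁ k₂ k₃ k₄ , σ)) →
      ⟨ρ⟩ (mkN p p' q q' 0ℤ 0ℤ 0ℤ 0ℤ , σ)
    bits {p} {p'} {q} {q'} {σ} v = with-q' q' (v 1F) (v 2F)
      where
      with-σ : ∀ σ → 1F ∈ K ⊎ Vanish 1F (_ , σ) → ⟨ρ⟩ (εᴺ , σ)
      with-σ false _           = one
      with-σ true  (inj₁ 1∈K) = generator 1∈K
      with-p : ∀ p → 0F ∈ K ⊎ Vanish 0F (mkN p _ _ _ _ _ _ _ , _) → ⟨ρ⟩ (mkN p false false false 0ℤ 0ℤ 0ℤ 0ℤ , σ)
      with-p false _          = with-σ σ (v 1F)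
      with-p true  (inj₁ 0∈K) = mul (generator 0∈K) (with-σ σ (v 1F))
      with-p' : ∀ p' → 0F ∈ K ⊎ Vanish 0F (mkN _ p' _ _ _ _ _ _ , _) → 1F ∈ K ⊎ Vanish 1F (mkN _ p' _ _ _ _ _ _ , _) →
        ⟨ρ⟩ (mkN p p' false false 0ℤ 0ℤ 0ℤ 0ℤ , σ)
      with-p' false _ _                   = with-p p (v 0F)
      with-p' true (inj₁ 0∈K) (inj₁ 1∈K) = mul (conjugate (generator 1∈K) (generator 0∈K)) (with-p p (v 0F))
      with-q : ∀ q → 2F ∈ K ⊎ Vanish 2F (mkN _ _ q _ _ _ _ _ , _) → ⟨ρ⟩ (mkN p p' q false 0ℤ 0ℤ 0ℤ 0ℤ , σ)
      with-q false _          = with-p' p' (v 0F) (v 1F)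
      with-q true  (inj₁ 2∈K) = mul (generator 2∈K) (with-p' p' (v 0F) (v 1F))
      with-q' : ∀ q' → 1F ∈ K ⊎ Vanish 1F (mkN _ _ _ q' _ _ _ _ , _) → 2F ∈ K ⊎ Vanish 2F (mkN _ _ _ q' _ _ _ _ , _) →
        ⟨ρ⟩ (mkN p p' q q' 0ℤ 0ℤ 0ℤ 0ℤ , σ)
      with-q' false _ _                   = with-q q (v 2F)
      with-q' true (inj₁ 1∈K) (inj₁ 2∈K) = mul (conjugate (generator 1∈K) (generator 2∈K)) (with-q q (v 2F))

  -- An element is a translation times a word `bits`. A nonzero coordinate excludes `Vanish i` for
  -- every ρᵢ needed to produce it, so these generators lie in `K`; for a zero coordinate the factor
  -- is trivial.
  ⟨ρ⟩-spans : ∀ u → (∀ i → i ∈ K ⊎ Vanish i u) → ⟨ρ⟩ u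
  ⟨ρ⟩-spans (mkN p p' q q' k₁ k₂ k₃ k₄ , σ) v =
    subst ⟨ρ⟩ (trans (T-· k₁ k₂ k₃ k₄ p p' q q' 0ℤ 0ℤ 0ℤ 0ℤ σ) (cong (_, σ) (mkN-cong refl refl refl refl
      (ℤ.+-identityʳ k₁) (ℤ.+-identityʳ k₂) (ℤ.+-identityʳ k₃) (ℤ.+-identityʳ k₄))))
      (mul (subst ⟨ρ⟩ T-sum (mul (mul (t₁ (v 0F) (v 1F)) (t₂ (v 1F) (v 2F)))
        (mul (t₃ (v 0F) (v 1F) (v 2F)) (t₄ (v 0F) (v 1F) (v 2F))))) (bits v))
    where
    T-sum : (T k₁ 0ℤ 0ℤ 0ℤ · T 0ℤ k₂ 0ℤ 0ℤ) · (T 0ℤ 0ℤ k₃ 0ℤ · T 0ℤ 0ℤ 0ℤ k₄) ≡ T k₁ k₂ k₃ k₄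
    T-sum = cong (_, false) (mkN-cong refl refl refl refl (l₁ k₁) (l₂ k₂) (l₃ k₃) (l₄ k₄))
      where
      l₁ : ∀ k → k + 0ℤ + 0ℤ + (0ℤ + 0ℤ + 0ℤ) + 0ℤ ≡ k
      l₁ = solve-∀
      l₂ : ∀ k → 0ℤ + k + 0ℤ + (0ℤ + 0ℤ + 0ℤ) + 0ℤ ≡ k
      l₂ = solve-∀
      l₃ : ∀ k → 0ℤ + 0ℤ + 0ℤ + (k + 0ℤ + 0ℤ) + 0ℤ ≡ k
      l₃ = solve-∀
      l₄ : ∀ k → 0ℤ + 0ℤ + 0ℤ + (0ℤ + k + 0ℤ) + 0ℤ ≡ k
      l₄ = solve-∀
    t₁ : ∀ {k} → 0F ∈ K ⊎ Vanish 0F (mkN _ _ _ _ k _ _ _ , _) → 1F ∈ K ⊎ Vanish 1F (mkN _ _ _ _ k _ _ _ , _) →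
      ⟨ρ⟩ (T k 0ℤ 0ℤ 0ℤ)
    t₁ (inj₂ vanish₀) _              = one
    t₁ (inj₁ _)       (inj₂ vanish₁) = one
    -- In each pair vu is x ↦ x + 1, so (vu)² has k = 1 and (uv)² has k = -1. Squaring clears the
    -- parities and leaves the other three coordinates zero.
    t₁ (inj₁ 0∈K)     (inj₁ 1∈K)     = multiples (λ z → T z 0ℤ 0ℤ 0ℤ)
      (λ k l → T-· k 0ℤ 0ℤ 0ℤ false false false false l 0ℤ 0ℤ 0ℤ false) refl (square ρ₀' ρ₀) (square ρ₀ ρ₀') _
      where
      ρ₀ = generator 0∈K
      ρ₀' = conjugate (generator 1∈K) ρ₀
    t₂ : ∀ {k} → 1F ∈ K ⊎ Vanish 1F (mkN _ _ _ _ _ k _ _ , _) → 2F ∈ K ⊎ Vanish 2F (mkN _ _ _ _ _ k _ _ , _) →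
      ⟨ρ⟩ (T 0ℤ k 0ℤ 0ℤ)
    t₂ (inj₂ vanish₁) _              = one
    t₂ (inj₁ _)       (inj₂ vanish₂) = one
    t₂ (inj₁ 1∈K)     (inj₁ 2∈K)     = multiples (λ z → T 0ℤ z 0ℤ 0ℤ)
      (λ k l → T-· 0ℤ k 0ℤ 0ℤ false false false false 0ℤ l 0ℤ 0ℤ false) refl (square ρ₂' ρ₂) (square ρ₂ ρ₂') _
      where
      ρ₂ = generator 2∈K
      ρ₂' = conjugate (generator 1∈K) ρ₂
    t₃ : ∀ {k} → 0F ∈ K ⊎ Vanish 0F (mkN _ _ _ _ _ _ k _ , _) → 1F ∈ K ⊎ Vanish 1F (mkN _ _ _ _ _ _ k _ , _) →
      2F ∈ K ⊎ Vanish 2F (mkN _ _ _ _ _ _ k _ , _) → ⟨ρ⟩ (T 0ℤ 0ℤ k 0ℤ)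
    t₃ (inj₂ vanish₀) _              _              = one
    t₃ (inj₁ _)       (inj₂ vanish₁) _              = one
    t₃ (inj₁ _)       (inj₁ _)       (inj₂ vanish₂) = one
    t₃ (inj₁ 0∈K)     (inj₁ 1∈K)     (inj₁ 2∈K)     = multiples (λ z → T 0ℤ 0ℤ z 0ℤ)
      (λ k l → T-· 0ℤ 0ℤ k 0ℤ false false false false 0ℤ 0ℤ l 0ℤ false) refl (square ρ₂' ρ₀) (square ρ₀ ρ₂') _
      where
      ρ₀ = generator 0∈K
      ρ₂' = conjugate (generator 1∈K) (generator 2∈K)
    t₄ : ∀ {k} → 0F ∈ K ⊎ Vanish 0F (mkN _ _ _ _ _ _ _ k , _) → 1F ∈ K ⊎ Vanish 1F (mkN _ _ _ _ _ _ _ k , _) →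
      2F ∈ K ⊎ Vanish 2F (mkN _ _ _ _ _ _ _ k , _) → ⟨ρ⟩ (T 0ℤ 0ℤ 0ℤ k)
    t₄ (inj₂ vanish₀) _              _              = one
    t₄ (inj₁ _)       (inj₂ vanish₁) _              = one
    t₄ (inj₁ _)       (inj₁ _)       (inj₂ vanish₂) = one
    t₄ (inj₁ 0∈K)     (inj₁ 1∈K)     (inj₁ 2∈K)     = multiples (λ z → T 0ℤ 0ℤ 0ℤ z)
      (λ k l → T-· 0ℤ 0ℤ 0ℤ k false false false false 0ℤ 0ℤ 0ℤ l false) refl (square ρ₂ ρ₀') (square ρ₀' ρ₂) _
      where
      ρ₂ = generator 2∈K
      ρ₀' = conjugate (generator 1∈K) (generator 0∈K)

-- The finite quotients

-- The lattice {(a , b) : X ∣ a + b , Y ∣ b} is invariant under (a , b) ↦ (b , a) because Y ∣ X,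
-- and under (a , b) ↦ (a , −b) because X ∣ 2Y.
module Construction (A B X Y : ℕ) {{_ : NonZero A}} {{_ : NonZero B}} {{_ : NonZero X}} {{_ : NonZero Y}}
  (Y∣X : + Y ∣ + X) (X∣2Y : + X ∣ + 2 * + Y) where

  record _≋ᴸ_ (v w : ℤ × ℤ) : Set where
    constructor mk≋ᴸ
    field
      sum    : (proj₁ v + proj₂ v) ≋[ X ] (proj₁ w + proj₂ w)
      second : proj₂ v ≋[ Y ] proj₂ w

  ≋ᴸ-refl : ∀ v → v ≋ᴸ v
  ≋ᴸ-refl v = mk≋ᴸ (≋-refl _) (≋-refl _)

  ≋ᴸ-+ : ∀ {a b c d a' b' c' d'} → (a , b) ≋ᴸ (a' , b') → (c , d) ≋ᴸ (c' , d') →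
    (a + c , b + d) ≋ᴸ (a' + c' , b' + d')
  ≋ᴸ-+ {a} {b} {c} {d} {a'} {b'} {c'} {d'} (mk≋ᴸ h h') (mk≋ᴸ g g') =
    mk≋ᴸ (subst₂ _≋[ X ]_ (lemma a b c d) (lemma a' b' c' d') (≋-+ h g)) (≋-+ h' g')
    where
    lemma : ∀ a b c d → a + b + (c + d) ≡ a + c + (b + d)
    lemma = solve-∀

  ≋ᴸ-neg : ∀ {a b a' b'} → (a , b) ≋ᴸ (a' , b') → (- a , - b) ≋ᴸ (- a' , - b')
  ≋ᴸ-neg {a} {b} {a'} {b'} (mk≋ᴸ h h') =
    mk≋ᴸ (subst₂ _≋[ X ]_ (ℤ.neg-distrib-+ a b) (ℤ.neg-distrib-+ a' b') (≋-neg h)) (≋-neg h')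

  -- Write a - b as (a + b) - 2b and use that X divides 2Y.
  ≋ᴸ-conj : ∀ {a b a' b'} → (a , b) ≋ᴸ (a' , b') → (a , - b) ≋ᴸ (a' , - b')
  ≋ᴸ-conj {a} {b} {a'} {b'} (mk≋ᴸ (mk≋ h) h'@(mk≋ (divides w eq))) =
    mk≋ᴸ (mk≋ (subst (+ X ∣_) (lemma a b a' b') (∣m∣n⇒∣m-n h (subst (+ X ∣_) twice (∣n⇒∣m*n w X∣2Y))))) (≋-neg h')
    where
    lemma : ∀ a b a' b' → (a + b - (a' + b')) - + 2 * (b - b') ≡ a + - b - (a' + - b')
    lemma = solve-∀
    comm : ∀ w y → w * (+ 2 * y) ≡ + 2 * (w * y)
    comm = solve-∀
    twice : w * (+ 2 * + Y) ≡ + 2 * (b - b')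
    twice = trans (comm w (+ Y)) (cong (+ 2 *_) (sym eq))

  ≋ᴸ-swap : ∀ {a b a' b'} → (a , b) ≋ᴸ (a' , b') → (b , a) ≋ᴸ (b' , a')
  ≋ᴸ-swap {a} {b} {a'} {b'} (mk≋ᴸ h@(mk≋ d) (mk≋ d')) =
    mk≋ᴸ (subst₂ _≋[ X ]_ (ℤ.+-comm a b) (ℤ.+-comm a' b') h)
      (mk≋ (subst (+ Y ∣_) (lemma a b a' b') (∣m∣n⇒∣m-n (∣-trans Y∣X d) d')))
    where
    lemma : ∀ a b a' b' → (a + b - (a' + b')) - (b - b') ≡ a - a'
    lemma = solve-∀

  -- Elements of `N` act on `k₃` and `k₄` by independent signs.
  ≋ᴸ-sgn : ∀ d e {a b a' b'} → (a , b) ≋ᴸ (a' , b') → (sgn d a , sgn e b) ≋ᴸ (sgn d a' , sgn e b')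
  ≋ᴸ-sgn false false h = h
  ≋ᴸ-sgn false true  h = ≋ᴸ-conj h
  ≋ᴸ-sgn true  true  h = ≋ᴸ-neg h
  ≋ᴸ-sgn true  false {a} {b} {a'} {b'} h =
    subst₂ (λ x y → (- a , x) ≋ᴸ (- a' , y)) (ℤ.neg-involutive b) (ℤ.neg-involutive b') (≋ᴸ-conj (≋ᴸ-neg h))

  -- Parities and `σ` must agree exactly. `k₃` and `k₄` are compared jointly, because ρ₁
  -- interchanges them.
  data _≈_ : U → U → Set where
    congruent : ∀ {p p' q q' σ k₁ k₂ k₃ k₄ l₁ l₂ l₃ l₄} →
      k₁ ≋[ A ] l₁ → k₂ ≋[ B ] l₂ → (k₃ , k₄) ≋ᴸ (l₃ , l₄) →
      (mkN p p' q q' k₁ k₂ k₃ k₄ , σ) ≈ (mkN p p' q q' l₁ l₂ l₃ l₄ , σ)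

  ≈-sym : ∀ {u v} → u ≈ v → v ≈ u
  ≈-sym (congruent h₁ h₂ (mk≋ᴸ h₃ h₄)) = congruent (≋-sym h₁) (≋-sym h₂) (mk≋ᴸ (≋-sym h₃) (≋-sym h₄))

  ≈-trans : ∀ {u v w} → u ≈ v → v ≈ w → u ≈ w
  ≈-trans (congruent h₁ h₂ (mk≋ᴸ h₃ h₄)) (congruent g₁ g₂ (mk≋ᴸ g₃ g₄)) =
    congruent (≋-trans h₁ g₁) (≋-trans h₂ g₂) (mk≋ᴸ (≋-trans h₃ g₃) (≋-trans h₄ g₄))

  swap-≈ : ∀ {x y s} → (x , s) ≈ (y , s) → (swap x , s) ≈ (swap y , s)
  swap-≈ (congruent {p} {p'} {q} {q'} h₁ h₂ h₃) =
    congruent (≋-kswap p p' h₁) (≋-kswap q q' h₂) (≋ᴸ-swap h₃)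

  invᴺ-≈ : ∀ {x y s} → (x , s) ≈ (y , s) → (invᴺ x , s) ≈ (invᴺ y , s)
  invᴺ-≈ (congruent {p} {p'} {q} {q'} h₁ h₂ h₃) = congruent (≋-kinv p p' h₁) (≋-kinv q q' h₂)
    (≋ᴸ-sgn (p xor q') (p' xor q) (≋ᴸ-neg (≋ᴸ-+ h₃ (≋ᴸ-refl _))))

  invᵁ-≈ : ∀ {u v} → u ≈ v → invᵁ u ≈ invᵁ v
  invᵁ-≈ {_ , false} h@(congruent _ _ _) = invᴺ-≈ h
  invᵁ-≈ {_ , true}  h@(congruent _ _ _) = swap-≈ (invᴺ-≈ h)

  ·ᴺ-≈ : ∀ {x x' y y' s t} → (x , s) ≈ (x' , s) → (y , t) ≈ (y' , t) → (x ·ᴺ y , s xor t) ≈ (x' ·ᴺ y' , s xor t)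
  ·ᴺ-≈ (congruent {p} {p'} {q} {q'} h₁ h₂ h₃) (congruent {r} {r'} {s} {s'} g₁ g₂ g₃) =
    congruent (≋-⊞ p p' r' h₁ g₁) (≋-⊞ q q' s' h₂ g₂)
      (≋ᴸ-+ (≋ᴸ-+ h₃ (≋ᴸ-sgn (p xor q') (p' xor q) g₃)) (≋ᴸ-refl _))

  ·-≈ : ∀ {u u' v v'} → u ≈ u' → v ≈ v' → (u · v) ≈ (u' · v')
  ·-≈ {_ , false} h@(congruent _ _ _) g@(congruent _ _ _) = ·ᴺ-≈ h g
  ·-≈ {_ , true}  h@(congruent _ _ _) g@(congruent _ _ _) = ·ᴺ-≈ h (swap-≈ g)

  C : Set
  C = (Bool × Bool × Bool × Bool × Bool) × Fin A × Fin B × Fin X × Fin Y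

  π : U → C
  π (mkN p p' q q' k₁ k₂ k₃ k₄ , σ) =
    (p , p' , q , q' , σ) , residue k₁ , residue k₂ , residue (k₃ + k₄) , residue k₄

  sect : C → U
  sect ((p , p' , q , q' , σ) , a , b , x , y) = mkN p p' q q' (repr a) (repr b) (repr x - repr y) (repr y) , σ

  cancel : ∀ x y → x - y + y ≡ x
  cancel = solve-∀

  π-sect : ∀ c → π (sect c) ≡ c
  π-sect (bits , a , b , x , y) = cong (bits ,_) (cong₂ _,_ (residue-repr a) (cong₂ _,_ (residue-repr b)
    (cong₂ _,_ (trans (cong residue (cancel (repr x) (repr y))) (residue-repr x)) (residue-repr y))))

  π-cong : ∀ {u v} → u ≈ v → π u ≡ π v
  π-cong (congruent h₁ h₂ (mk≋ᴸ h₃ h₄)) = cong (_ ,_) (cong₂ _,_ (residue-cong h₁)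
    (cong₂ _,_ (residue-cong h₂) (cong₂ _,_ (residue-cong h₃) (residue-cong h₄))))

  sect-π : ∀ u → sect (π u) ≈ u
  sect-π (mkN p p' q q' k₁ k₂ k₃ k₄ , σ) = congruent (repr-residue k₁) (repr-residue k₂)
    (mk≋ᴸ (subst (_≋[ X ] (k₃ + k₄)) (sym (cancel (repr {X} (residue (k₃ + k₄))) (repr {Y} (residue k₄))))
      (repr-residue (k₃ + k₄))) (repr-residue k₄))

  -- Both elements are congruent to the same lifted normal form.
  π-injective : ∀ {u v} → π u ≡ π v → u ≈ v
  π-injective {u} {v} e = ≈-trans (≈-sym (sect-π u)) (subst (λ c → sect c ≈ v) (sym e) (sect-π v))

  π-·-resp : ∀ {u u' v v'} → π u ≡ π u' → π v ≡ π v' → π (u · v) ≡ π (u' · v')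
  π-·-resp {u} {u'} {v} {v'} e f = π-cong (·-≈ (π-injective {u} {u'} e) (π-injective {v} {v'} f))

  π-inv-resp : ∀ {u u'} → π u ≡ π u' → π (invᵁ u) ≡ π (invᵁ u')
  π-inv-resp {u} {u'} e = π-cong (invᵁ-≈ (π-injective {u} {u'} e))

  open Quotient U-isGroup π sect π-sect (λ {u} {u'} {v} {v'} → π-·-resp {u} {u'} {v} {v'}) (λ {u} {u'} → π-inv-resp {u} {u'})

  ρ : Fin 3 → C
  ρ i = π (ρᵁ i)

  -- The section lifts the residue of 0 to the integer 0 itself, so zero coordinates survive
  -- reduction followed by lifting.
  Vanish-sect-π : ∀ {i u} → Vanish i u → Vanish i (sect (π u))
  Vanish-sect-π = λ
    { vanish₀ → zeros₀ zero-A zero-XY zero-Y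
    ; vanish₁ → zeros₁ zero-A zero-B zero-XY zero-Y
    ; vanish₂ → zeros₂ zero-B zero-XY zero-Y }
    where
    zeros₀ : ∀ {q q' k₁ k₂ k₃ k₄ σ} → k₁ ≡ 0ℤ → k₃ ≡ 0ℤ → k₄ ≡ 0ℤ →
      Vanish 0F (mkN false false q q' k₁ k₂ k₃ k₄ , σ)
    zeros₀ refl refl refl = vanish₀
    zeros₁ : ∀ {p q k₁ k₂ k₃ k₄} → k₁ ≡ 0ℤ → k₂ ≡ 0ℤ → k₃ ≡ 0ℤ → k₄ ≡ 0ℤ →
      Vanish 1F (mkN p false q false k₁ k₂ k₃ k₄ , false)
    zeros₁ refl refl refl refl = vanish₁
    zeros₂ : ∀ {p p' k₁ k₂ k₃ k₄ σ} → k₂ ≡ 0ℤ → k₃ ≡ 0ℤ → k₄ ≡ 0ℤ →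
      Vanish 2F (mkN p p' false false k₁ k₂ k₃ k₄ , σ)
    zeros₂ refl refl refl = vanish₂
    zero-A : repr {A} (residue 0ℤ) ≡ 0ℤ
    zero-A = repr-residue-0
    zero-B : repr {B} (residue 0ℤ) ≡ 0ℤ
    zero-B = repr-residue-0
    zero-Y : repr {Y} (residue 0ℤ) ≡ 0ℤ
    zero-Y = repr-residue-0
    zero-XY : repr {X} (residue 0ℤ) - repr {Y} (residue 0ℤ) ≡ 0ℤ
    zero-XY = cong₂ _-_ (repr-residue-0 {X}) zero-Y

  -- The intersection property.

  G[_] : Subset 3 → C → Set
  G[ I ] = Gen _∙_ ε _⁻¹ (λ y → ∃ λ i → i ∈ I × y ≡ ρ i)

  G⇒Vanish : ∀ {I i x} → i ∉ I → G[ I ] x → Vanish i (sect x)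
  G⇒Vanish {i = i} i∉I (gen (j , j∈I , refl)) =
    Vanish-sect-π (Vanish-ρ i j λ { refl → i∉I j∈I })
  G⇒Vanish {i = i} i∉I one = Vanish-sect-π (Vanish-ε i)
  G⇒Vanish i∉I (mul g h) = Vanish-sect-π (Vanish-· (G⇒Vanish i∉I g) (G⇒Vanish i∉I h))
  G⇒Vanish i∉I (inv g) = Vanish-sect-π (Vanish-inv (G⇒Vanish i∉I g))

  Vanish⇒G : ∀ I x → (∀ i → i ∈ I ⊎ Vanish i (sect x)) → G[ I ] x
  Vanish⇒G I x v = subst G[ I ] (π-sect x) (π-Gen (λ { (i , i∈I , refl) → i , i∈I , refl }) (⟨ρ⟩-spans I (sect x) v))

  -- By the two preceding lemmas `G[ I ]` is cut out by the conditions `Vanish i` with i outside I,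
  -- and an index outside I ∩ J is outside I or outside J.
  G-∩ : ∀ I J x → G[ I ] x → G[ J ] x → G[ I ∩ J ] x
  G-∩ I J x g h = Vanish⇒G (I ∩ J) x v
    where
    v : ∀ i → i ∈ I ∩ J ⊎ Vanish i (sect x)
    v i with i ∈? I | i ∈? J
    ... | yes i∈I | yes i∈J = inj₁ (x∈p∩q⁺ (i∈I , i∈J))
    ... | no i∉I  | _       = inj₂ (G⇒Vanish i∉I g)
    ... | _       | no i∉J  = inj₂ (G⇒Vanish i∉J h)

  G-⊤ : ∀ {x} → G[ ⊤ ] x → Gen _∙_ ε _⁻¹ (λ y → ∃ λ i → y ≡ ρ i) x
  G-⊤ (gen (i , _ , e)) = gen (i , e)
  G-⊤ one               = one
  G-⊤ (mul g h)         = mul (G-⊤ g) (G-⊤ h)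
  G-⊤ (inv g)           = inv (G-⊤ g)

  ρ≢ε : ∀ i → ρ i ≢ ε
  ρ≢ε 0F ()
  ρ≢ε 1F ()
  ρ≢ε 2F ()

  ρ-square : ∀ i → pow _∙_ ε (ρ i) 2 ≡ ε
  ρ-square i = trans (sym (π-pow (ρᵁ i) 2)) (cong π (square i))
    where
    square : ∀ i → pow _·_ εᵁ (ρᵁ i) 2 ≡ εᵁ
    square 0F = refl
    square 1F = refl
    square 2F = refl

  ρ-involution : ∀ i → HasOrder _∙_ ε (ρ i) 2
  ρ-involution i = z<s , ρ-square i ,
    λ { 1 _ _ e → ρ≢ε i (trans (sym (IsGroup.identityʳ quotient-isGroup (ρ i))) e)
      ; (suc (suc _)) _ (s≤s (s≤s ())) _ }

  Γ : StringCGroup3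
  Γ = record
    { Carrier = C ; _∙_ = _∙_ ; ε = ε ; _⁻¹ = _⁻¹ ; isGroup = quotient-isGroup ; ρ = ρ
    ; involution = ρ-involution
    -- The two products have the same normal form in `U` by computation.
    ; stringProp = trans (sym (π-∙ (ρᵁ 0F) (ρᵁ 2F))) (π-∙ (ρᵁ 2F) (ρᵁ 0F))
    ; generates = λ x → G-⊤ (Vanish⇒G ⊤ x λ _ → inj₁ ∈⊤)
    ; intersection = G-∩ }

  -- The Schläfli type.

  order-4* : ∀ u (f : ℤ → U) → (∀ k l → f k · f l ≡ f (k + l)) → f 0ℤ ≡ εᵁ → pow _·_ εᵁ u 4 ≡ f 1ℤ →
    ∀ m .{{_ : NonZero m}} → f (+ m) ≈ εᵁ →
    (∀ r q → r ℕ.< 4 → (pow _·_ εᵁ u r · f (+ q)) ≈ εᵁ → r ≡ 0 × m ℕ.∣ q) →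
    HasOrder _∙_ ε (π u) (m ℕ.* 4)
  order-4* u f f-hom f-ε u⁴ m vanishes faithful =
    ℕ.>-nonZero⁻¹ (m ℕ.* 4) {{ℕ.m*n≢0 m 4}} ,
    trans (sym (π-pow u (m ℕ.* 4))) (trans (cong π (pow-* U-isGroup u f f-hom f-ε 4 u⁴ m)) (π-cong vanishes)) ,
    λ j 0<j j<4m e → ℕ.<⇒≢ 0<j (sym (j≡0 j j<4m (π-injective (trans (π-pow u j) e))))
    where
    -- Division by 4 reduces a relation on powers of `u` to `faithful`. For j < 4m the quotient is
    -- below m, so divisibility by m makes it zero along with the remainder.
    divmod : ∀ j → pow _·_ εᵁ u j ≡ pow _·_ εᵁ u (j ℕ.% 4) · f (+ (j ℕ./ 4))
    divmod j = begin
      pow _·_ εᵁ u j                                            ≡⟨ cong (pow _·_ εᵁ u) (ℕ.m≡m%n+[m/n]*n j 4) ⟩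
      pow _·_ εᵁ u (j ℕ.% 4 ℕ.+ j ℕ./ 4 ℕ.* 4)                  ≡⟨ pow-+ U-isGroup u (j ℕ.% 4) _ ⟩
      pow _·_ εᵁ u (j ℕ.% 4) · pow _·_ εᵁ u (j ℕ./ 4 ℕ.* 4)     ≡⟨ cong (pow _·_ εᵁ u (j ℕ.% 4) ·_) (pow-* U-isGroup u f f-hom f-ε 4 u⁴ (j ℕ./ 4)) ⟩
      pow _·_ εᵁ u (j ℕ.% 4) · f (+ (j ℕ./ 4))                  ∎
      where open ≡-Reasoning
    j≡0 : ∀ j → j ℕ.< m ℕ.* 4 → pow _·_ εᵁ u j ≈ εᵁ → j ≡ 0
    j≡0 j j<4m h with r≡0 , m∣q ← faithful (j ℕ.% 4) (j ℕ./ 4) (ℕ.m%n<n j 4) (subst (_≈ εᵁ) (divmod j) h) =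
      trans (ℕ.m≡m%n+[m/n]*n j 4) (cong₂ ℕ._+_ r≡0 (cong (ℕ._* 4) (∣∧<⇒≡0 m∣q (ℕ.m<n*o⇒m/o<n j<4m))))

  order-ρ₀ρ₁ : HasOrder _∙_ ε (ρ 0F ∙ ρ 1F) (A ℕ.* 4)
  order-ρ₀ρ₁ = subst (λ x → HasOrder _∙_ ε x (A ℕ.* 4)) (π-∙ (ρᵁ 0F) (ρᵁ 1F))
    -- The fourth power of ρ₀ρ₁ is (ρ₀ρ₀′)² = (uv)², whence the minus sign; that of ρ₁ρ₂ is (ρ₂′ρ₂)²
    -- = (vu)², with k = 1.
    (order-4* (ρᵁ 0F · ρᵁ 1F) (λ k → T (- k) 0ℤ 0ℤ 0ℤ)
      (λ k l → trans (T-· (- k) 0ℤ 0ℤ 0ℤ false false false false (- l) 0ℤ 0ℤ 0ℤ false)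
        (cong (λ z → T z 0ℤ 0ℤ 0ℤ) (sym (ℤ.neg-distrib-+ k l))))
      refl refl A
      (congruent (≋-neg modulus≋0) (≋-refl 0ℤ) (≋ᴸ-refl (0ℤ , 0ℤ)))
      faithful)
    where
    faithful : ∀ r q → r ℕ.< 4 → (pow _·_ εᵁ (ρᵁ 0F · ρᵁ 1F) r · T (- (+ q)) 0ℤ 0ℤ 0ℤ) ≈ εᵁ → r ≡ 0 × A ℕ.∣ q
    -- For r = 1, 2, 3 the power has a nontrivial parity or `σ`, so it is not congruent to the
    -- identity and the case is empty.
    faithful 0 q _ (congruent h _ _) = refl , ≋0⇒∣ (subst (_≋[ A ] 0ℤ) (lemma (+ q)) (≋-neg h))
      where
      lemma : ∀ k → - (0ℤ + - k + 0ℤ) ≡ k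
      lemma = solve-∀
    faithful (suc (suc (suc (suc _)))) q (s≤s (s≤s (s≤s (s≤s ())))) _

  order-ρ₁ρ₂ : HasOrder _∙_ ε (ρ 1F ∙ ρ 2F) (B ℕ.* 4)
  order-ρ₁ρ₂ = subst (λ x → HasOrder _∙_ ε x (B ℕ.* 4)) (π-∙ (ρᵁ 1F) (ρᵁ 2F))
    (order-4* (ρᵁ 1F · ρᵁ 2F) (λ k → T 0ℤ k 0ℤ 0ℤ)
      (λ k l → T-· 0ℤ k 0ℤ 0ℤ false false false false 0ℤ l 0ℤ 0ℤ false)
      refl refl B
      (congruent (≋-refl 0ℤ) modulus≋0 (≋ᴸ-refl (0ℤ , 0ℤ)))
      faithful)
    where
    faithful : ∀ r q → r ℕ.< 4 → (pow _·_ εᵁ (ρᵁ 1F · ρᵁ 2F) r · T 0ℤ (+ q) 0ℤ 0ℤ) ≈ εᵁ → r ≡ 0 × B ℕ.∣ q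
    faithful 0 q _ (congruent _ h _) = refl , ≋0⇒∣ (subst (_≋[ B ] 0ℤ) (lemma (+ q)) h)
      where
      lemma : ∀ k → 0ℤ + k + 0ℤ ≡ k
      lemma = solve-∀
    faithful (suc (suc (suc (suc _)))) q (s≤s (s≤s (s≤s (s≤s ())))) _

  C↔Fin : C ↔ Fin ((2 ℕ.* (2 ℕ.* (2 ℕ.* (2 ℕ.* 2)))) ℕ.* (A ℕ.* (B ℕ.* (X ℕ.* Y))))
  C↔Fin = (bool ⊗ (bool ⊗ (bool ⊗ (bool ⊗ bool)))) ⊗ (↔-refl ⊗ (↔-refl ⊗ (↔-refl ⊗ ↔-refl)))
    where
    bool : Bool ↔ Fin 2
    bool = ↔-sym Fin.2↔Bool
    _⊗_ : ∀ {P Q : Set} {m n} → P ↔ Fin m → Q ↔ Fin n → (P × Q) ↔ Fin (m ℕ.* n)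
    f ⊗ g = ↔-trans (f ×-↔ g) (↔-sym Fin.*↔×)

-- Choice of the moduli for given n, s and t.

2^-∣ : ∀ {i k} → i ≤ k → 2 ^ i ℕ.∣ 2 ^ k
2^-∣ {i} {k} i≤k = ℕ.divides (2 ^ (k ∸ i))
  (trans (cong (2 ^_) (sym (ℕ.m∸n+n≡m i≤k))) (ℕ.^-distribˡ-+-* 2 (k ∸ i) i))

theorem1p1 : ∀ (n s t : ℕ) → 10 ≤ n → 2 ≤ s → 2 ≤ t → s ℕ.+ t ≤ n ∸ 1 →
    Σ StringCGroup3 λ Γ →
    (StringCGroup3.Carrier Γ ↔ Fin (2 ^ n))
    × HasOrder (StringCGroup3._∙_ Γ) (StringCGroup3.ε Γ)
    (StringCGroup3._∙_ Γ (StringCGroup3.ρ Γ Fin.zero) (StringCGroup3.ρ Γ (Fin.suc Fin.zero))) (2 ^ s)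
    × HasOrder (StringCGroup3._∙_ Γ) (StringCGroup3.ε Γ)
    (StringCGroup3._∙_ Γ (StringCGroup3.ρ Γ (Fin.suc Fin.zero)) (StringCGroup3.ρ Γ (Fin.suc (Fin.suc Fin.zero)))) (2 ^ t)
theorem1p1 (suc n) (suc (suc a)) (suc (suc b)) _ (s≤s (s≤s _)) (s≤s (s≤s _)) s+t≤n =
  Γ , subst (λ m → C ↔ Fin m) size C↔Fin ,
  subst (HasOrder _ _ _) (sym (quadruple a)) order-ρ₀ρ₁ ,
  subst (HasOrder _ _ _) (sym (quadruple b)) order-ρ₁ρ₂
  where
  r i j : ℕ
  -- Matching has taken one off the exponent, so the order is to be 2^(n+1), and 32 · 2^a · 2^b ·
  -- 2^r attains it when 5 + a + b + r = n + 1. Rounding r/2 up for X and down for Y gives X = Y or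
  -- X = 2Y.
  r = n ∸ (2 ℕ.+ a ℕ.+ (2 ℕ.+ b))
  i = ⌈ r /2⌉
  j = ⌊ r /2⌋
  quadruple : ∀ k → 2 ^ (2 ℕ.+ k) ≡ 2 ^ k ℕ.* 4
  quadruple k = trans (sym (ℕ.*-assoc 2 2 (2 ^ k))) (ℕ.*-comm 4 (2 ^ k))
  open Construction (2 ^ a) (2 ^ b) (2 ^ i) (2 ^ j)
    {{ℕ.m^n≢0 2 a}} {{ℕ.m^n≢0 2 b}} {{ℕ.m^n≢0 2 i}} {{ℕ.m^n≢0 2 j}}
    (∣ᵤ⇒∣ (2^-∣ (ℕ.⌊n/2⌋≤⌈n/2⌉ r)))
    -- The exponents compare as ⌈r/2⌉ = ⌊(r+1)/2⌋ ≤ ⌊(r+2)/2⌋ = 1 + ⌊r/2⌋.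
    (subst (+ (2 ^ i) ∣_) (ℤ.pos-* 2 (2 ^ j)) (∣ᵤ⇒∣ (2^-∣ {i} {suc j} (ℕ.⌊n/2⌋-mono (ℕ.n≤1+n (suc r))))))
  size : 32 ℕ.* (2 ^ a ℕ.* (2 ^ b ℕ.* (2 ^ i ℕ.* 2 ^ j))) ≡ 2 ^ suc n
  size = begin
    32 ℕ.* (2 ^ a ℕ.* (2 ^ b ℕ.* (2 ^ i ℕ.* 2 ^ j))) ≡⟨ cong (λ z → 32 ℕ.* (2 ^ a ℕ.* (2 ^ b ℕ.* z))) (ℕ.^-distribˡ-+-* 2 i j) ⟨
    32 ℕ.* (2 ^ a ℕ.* (2 ^ b ℕ.* 2 ^ (i ℕ.+ j)))     ≡⟨ cong (λ z → 32 ℕ.* (2 ^ a ℕ.* z)) (ℕ.^-distribˡ-+-* 2 b (i ℕ.+ j)) ⟨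
    32 ℕ.* (2 ^ a ℕ.* 2 ^ (b ℕ.+ (i ℕ.+ j)))         ≡⟨ cong (32 ℕ.*_) (ℕ.^-distribˡ-+-* 2 a (b ℕ.+ (i ℕ.+ j))) ⟨
    2 ^ 5 ℕ.* 2 ^ (a ℕ.+ (b ℕ.+ (i ℕ.+ j)))          ≡⟨ ℕ.^-distribˡ-+-* 2 5 (a ℕ.+ (b ℕ.+ (i ℕ.+ j))) ⟨
    2 ^ (5 ℕ.+ (a ℕ.+ (b ℕ.+ (i ℕ.+ j))))            ≡⟨ cong (2 ^_) exponent ⟩
    2 ^ suc n                                        ∎
    where
    open ≡-Reasoning
    regroup : ∀ a b r → 5 ℕ.+ (a ℕ.+ (b ℕ.+ r)) ≡ 1 ℕ.+ (2 ℕ.+ a ℕ.+ (2 ℕ.+ b) ℕ.+ r)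
    regroup = ℕ-solve-∀
    exponent : 5 ℕ.+ (a ℕ.+ (b ℕ.+ (i ℕ.+ j))) ≡ suc n
    exponent = trans (cong (λ z → 5 ℕ.+ (a ℕ.+ (b ℕ.+ z))) (trans (ℕ.+-comm i j) (ℕ.⌊n/2⌋+⌈n/2⌉≡n r)))
      (trans (regroup a b r) (cong suc (ℕ.m+[n∸m]≡n s+t≤n)))
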